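{- Let $P'_1, P'_2$ be definite clause logic programs. For $i=1,2$ let $F_i$ be the set of the predicate symbols occurring in $P'_i$, and assume that $F_1\cap F_2=\emptyset$. Call an atom $A$ an $F_i$-atom if the predicate symbol of $A$ is in $F_i$. Assume that each variable occurring in a rule of $P'_1$ occurs in the head of that rule, and each variable occurring in a rule of $P'_2$ occurs in the body of that rule. Let $\mathcal{R}$ be a partial selection rule under which each floundered query consists solely of non-ground $F_1$-atoms. Let $Q$ be a query such that each variable of $Q$ occurs in an $F_2$-atom of $Q$. Then no derivation of $P'_1\cup P'_2$ for $Q$ via $\mathcal{R}$ flounders.
   Context: Programs are sets of definite clauses, called rules, $H\gets B_1,\ldots,B_n$ ($n\ge 0$) with head $H$ and body $B_1,\ldots,B_n$; queries are finite sequences of atoms. Derivations are SLD-derivations (with rules renamed apart and most general unifiers in each step), generalized so that the selection rule may be a partial function (a partial selection rule): in some non-empty queries no atom may be selected. A non-empty query in which no atom is selected is called floundered. A derivation flounders if a floundered query occurs in it. -}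

module Defs where

open import Data.Fin.Base using (Fin; toℕ)
open import Data.List.Base using (List; []; _∷_; _++_; length; lookup; take; drop)
open import Data.List.Membership.Propositional using () renaming (_∈_ to _∈ˡ_)
open import Data.List.Relation.Unary.Any using (Any)
open import Data.Maybe.Base using (Maybe; just; nothing)
open import Data.Nat.Base using (ℕ; zero; suc)
open import Data.Product.Base using (Σ; ∃-syntax; _×_)
open import Data.Sum.Base using (_⊎_)
open import Data.Unit.Base using (⊤)
open import Data.Vec.Base using (Vec; []; _∷_)
import Data.Vec.Relation.Unary.Any as Vec
open import Function.Bundles using (_↔_; Inverse)
open import Level using (0ℓ)
open import Relation.Binary.Construct.Closure.ReflexiveTransitive using (Star)
open import Relation.Binary.PropositionalEquality using (_≡_; _≢_)
open import Relation.Nullary.Negation using (¬_)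
open import Relation.Unary using (Pred; _∈_)

record Signature : Set₁ where
  field
    FunSym    : Set
    PredSym   : Set
    funArity  : FunSym → ℕ
    predArity : PredSym → ℕ

module SLD (S : Signature) where

  open Signature S

  Var : Set
  Var = ℕ

  data Term : Set where
    var : Var → Term
    fun : (f : FunSym) → Vec Term (funArity f) → Term

  record Atom : Set where
    constructor atom
    field
      predSym : PredSym
      args    : Vec Term (predArity predSym)

  open Atom public

  Query : Set
  Query = List Atom

  infix 4 _⟵_
  record Rule : Set where
    constructor _⟵_
    field
      head : Atom
      body : List Atom

  open Rule public

  Program : Set₁
  Program = Pred Rule 0ℓ

  data _∈ᵗ_ (x : Var) : Term → Set where
    here  : x ∈ᵗ var x
    there : ∀ {f ts} → Vec.Any (x ∈ᵗ_) ts → x ∈ᵗ fun f ts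

  _∈ᵃ_ : Var → Atom → Set
  x ∈ᵃ A = Vec.Any (x ∈ᵗ_) (args A)

  _∈ᑫ_ : Var → Query → Set
  x ∈ᑫ Q = Any (x ∈ᵃ_) Q

  _∈ʳ_ : Var → Rule → Set
  x ∈ʳ r = x ∈ᵃ head r ⊎ x ∈ᑫ body r

  Ground : Atom → Set
  Ground A = ∀ x → ¬ (x ∈ᵃ A)

  PredSyms : Program → Pred PredSym 0ℓ
  PredSyms P p = ∃[ r ] r ∈ P × Any (λ A → p ≡ predSym A) (head r ∷ body r)

  _-Atom : Pred PredSym 0ℓ → Pred Atom 0ℓ
  (F -Atom) A = predSym A ∈ F

  -- Substitutions are finite mappings: `support` contains the domain,
  -- possibly along with variables mapped to themselves.
  record Subst : Set where
    field
      _⟨_⟩    : Var → Term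
      support : List Var
      outside : ∀ x → ¬ (x ∈ˡ support) → _⟨_⟩ x ≡ var x

  open Subst public

  _∈ˢ_ : Var → Subst → Set
  x ∈ˢ θ = ∃[ y ] θ ⟨ y ⟩ ≢ var y × (x ≡ y ⊎ x ∈ᵗ (θ ⟨ y ⟩))

  mutual
    _[_]ᵗ : Term → Subst → Term
    var x    [ θ ]ᵗ = θ ⟨ x ⟩
    fun f ts [ θ ]ᵗ = fun f (ts [ θ ]ᵗˢ)

    _[_]ᵗˢ : ∀ {n} → Vec Term n → Subst → Vec Term n
    []       [ θ ]ᵗˢ = []
    (t ∷ ts) [ θ ]ᵗˢ = t [ θ ]ᵗ ∷ ts [ θ ]ᵗˢ

  _[_]ᵃ : Atom → Subst → Atom
  atom p ts [ θ ]ᵃ = atom p (ts [ θ ]ᵗˢ)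

  _[_]ᑫ : Query → Subst → Query
  []      [ θ ]ᑫ = []
  (A ∷ Q) [ θ ]ᑫ = A [ θ ]ᵃ ∷ Q [ θ ]ᑫ

  _[_]ʳ : Rule → Subst → Rule
  (H ⟵ B) [ θ ]ʳ = H [ θ ]ᵃ ⟵ B [ θ ]ᑫ

  IsRenaming : Subst → Set
  IsRenaming ρ = Σ (Var ↔ Var) λ π → ∀ x → ρ ⟨ x ⟩ ≡ var (Inverse.to π x)

  _IsVariantOf_ : Rule → Rule → Set
  r′ IsVariantOf r = ∃[ ρ ] IsRenaming ρ × r′ ≡ r [ ρ ]ʳ

  IsUnifier : Subst → Atom → Atom → Set
  IsUnifier θ A B = A [ θ ]ᵃ ≡ B [ θ ]ᵃ

  IsMGU : Subst → Atom → Atom → Set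
  IsMGU θ A B = IsUnifier θ A B ×
    (∀ η → IsUnifier η A B → ∃[ σ ] ∀ x → η ⟨ x ⟩ ≡ (θ ⟨ x ⟩) [ σ ]ᵗ)

  record Step (P : Program) (Q : Query) : Set where
    field
      selected : Fin (length Q)
      input    : Rule
      variant  : ∃[ r ] r ∈ P × input IsVariantOf r
      mgu      : Subst
      isMGU    : IsMGU mgu (lookup Q selected) (head input)

    resolvent : Query
    resolvent =
      (take (toℕ selected) Q ++ body input ++ drop (suc (toℕ selected)) Q) [ mgu ]ᑫ

  open Step public

  -- Finite initial fragments of SLD-derivations.  Rules are renamed apart
  -- from everything (queries, input rules, mgus) earlier in the derivation.
  mutual
    data Fragment (P : Program) : Set where
      start  : Query → Fragment P
      extend : (d : Fragment P) (s : Step P (last d)) →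
               (∀ x → x ∈ʳ input s → ¬ (x ∈ᶠ d)) → Fragment P

    last : ∀ {P} → Fragment P → Query
    last (start Q)      = Q
    last (extend _ s _) = resolvent s

    _∈ᶠ_ : ∀ {P} → Var → Fragment P → Set
    x ∈ᶠ start Q      = x ∈ᑫ Q
    x ∈ᶠ extend d s _ =
      x ∈ᶠ d ⊎ x ∈ʳ input s ⊎ x ∈ˢ mgu s ⊎ x ∈ᑫ resolvent s

  initial : ∀ {P} → Fragment P → Query
  initial (start Q)      = Q
  initial (extend d _ _) = initial d

  data _⟶_ {P : Program} (d : Fragment P) : Fragment P → Set where
    extends : ∀ {s apart} → d ⟶ extend d s apart

  -- Finite derivations are not required to be maximal.
  data Derivation (P : Program) : Set where
    finite   : Fragment P → Derivation P
    infinite : (Q : Query) (f : ℕ → Fragment P) →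
               f zero ≡ start Q → (∀ n → f n ⟶ f (suc n)) → Derivation P

  _IsPrefixOf_ : ∀ {P} → Fragment P → Derivation P → Set
  d IsPrefixOf finite e         = Star _⟶_ d e
  d IsPrefixOf infinite _ f _ _ = ∃[ n ] d ≡ f n

  -- The selection may depend on the whole history; `nothing` means that no
  -- atom is selected (which is always so when the last query is empty).
  PartialSelectionRule : Program → Set
  PartialSelectionRule P = (d : Fragment P) → Maybe (Fin (length (last d)))

  module _ {P : Program} (R : PartialSelectionRule P) where

    FragmentVia : Fragment P → Set
    FragmentVia (start _)      = ⊤
    FragmentVia (extend d s _) = FragmentVia d × R d ≡ just (selected s)

    IsDerivationFor : Query → Derivation P → Set
    IsDerivationFor Q D = ∀ d → d IsPrefixOf D → initial d ≡ Q × FragmentVia d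

    FlounderedAt : Fragment P → Set
    FlounderedAt d = last d ≢ [] × R d ≡ nothing

    FlounderedQuery : Query → Set
    FlounderedQuery Q = ∃[ d ] FragmentVia d × last d ≡ Q × FlounderedAt d

    Flounders : Derivation P → Set
    Flounders D = ∃[ d ] d IsPrefixOf D × FlounderedAt d

{-# OPTIONS --safe #-}

-- The property "each variable of the query occurs in an F₂-atom" is invariant
-- under resolution.  The selected atom A and the head H of the input rule have
-- the same instance under the mgu θ.  If the rule is from P₁, no F₂-atom is
-- removed, and the variables of the new atoms occur in Hθ = Aθ.  If it is from
-- P₂, the only removed F₂-atom is A, and the variables of Aθ = Hθ occur in the
-- new atoms, which are F₂-atoms.  A non-empty query with the property cannot
-- consist solely of non-ground F₁-atoms.
module Submission where

open import Defs
open import Data.Empty using (⊥-elim)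
open import Data.Fin.Base using (Fin; zero; suc; toℕ)
open import Data.List.Base using ([]; _∷_; _++_; length; lookup; take; drop; map)
open import Data.List.Membership.Propositional using (lose)
open import Data.List.Membership.Propositional.Properties using (∈-lookup)
open import Data.List.Relation.Unary.All as All using (All; []; _∷_)
import Data.List.Relation.Unary.All.Properties as All
open import Data.List.Relation.Unary.Any as Any using (Any; here; there)
import Data.List.Relation.Unary.Any.Properties as Any
open import Data.Nat.Base using (suc)
open import Data.Product.Base using (_×_; _,_; ∃-syntax; proj₁; proj₂)
open import Data.Sum.Base as Sum using (_⊎_; inj₁; inj₂)
open import Data.Vec.Base using (Vec; []; _∷_)
import Data.Vec.Relation.Unary.Any as Vec
open import Function.Base using (_∘_; id)
open import Level using (0ℓ)
open import Relation.Binary.PropositionalEquality using (_≡_; refl; sym; cong; subst)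
open import Relation.Nullary.Negation using (¬_)
open import Relation.Unary using (Pred; _∈_; _∩_; _∪_; Empty)

module _ {A : Set} {P : Pred A 0ℓ} where

  -- The list with `ys` in place of entry `i` has the shape of a resolvent before the mgu is
  -- applied, so this lemma and the next two locate atoms across a resolution step.
  replace⁻ : ∀ xs (i : Fin (length xs)) {ys} →
             Any P (take (toℕ i) xs ++ ys ++ drop (suc (toℕ i)) xs) →
             Any P xs ⊎ Any P ys
  replace⁻ (_ ∷ _)  zero {ys} p with Any.++⁻ ys p
  ... | inj₁ q = inj₂ q
  ... | inj₂ q = inj₁ (there q)
  replace⁻ (_ ∷ _)  (suc i) (here p)  = inj₁ (here p)
  replace⁻ (_ ∷ xs) (suc i) (there p) = Sum.map₁ there (replace⁻ xs i p)

  -- Replacement removes only entry `i`, so a witness is lost only if it was that entry.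
  replace⁺-old : ∀ xs (i : Fin (length xs)) {ys} → Any P xs →
                 P (lookup xs i) ⊎
                 Any P (take (toℕ i) xs ++ ys ++ drop (suc (toℕ i)) xs)
  replace⁺-old (_ ∷ _)  zero         (here p)  = inj₁ p
  replace⁺-old (_ ∷ _)  zero    {ys} (there p) = inj₂ (Any.++⁺ʳ ys p)
  replace⁺-old (_ ∷ _)  (suc i)      (here p)  = inj₂ (here p)
  replace⁺-old (_ ∷ xs) (suc i)      (there p) = Sum.map₂ there (replace⁺-old xs i p)

  replace⁺-new : ∀ xs (i : Fin (length xs)) {ys} → Any P ys →
                 Any P (take (toℕ i) xs ++ ys ++ drop (suc (toℕ i)) xs)
  replace⁺-new xs i = Any.++⁺ʳ (take (toℕ i) xs) ∘ Any.++⁺ˡ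

All-contradiction : ∀ {A : Set} {P : Pred A 0ℓ} {xs} → All P xs → All (¬_ ∘ P) xs → xs ≡ []
All-contradiction []      []       = refl
All-contradiction (p ∷ _) (¬p ∷ _) = ⊥-elim (¬p p)

module _ {S : Signature} where

  open Signature S
  open SLD S

  mutual
    ∈ᵗ-subst⁻ : ∀ t {θ x} → x ∈ᵗ (t [ θ ]ᵗ) → ∃[ y ] y ∈ᵗ t × x ∈ᵗ (θ ⟨ y ⟩)
    ∈ᵗ-subst⁻ (var y)    x∈         = y , here , x∈
    ∈ᵗ-subst⁻ (fun f ts) (there x∈) with ∈ᵗˢ-subst⁻ ts x∈
    ... | y , y∈ , x∈θy = y , there y∈ , x∈θy

    ∈ᵗˢ-subst⁻ : ∀ {n} (ts : Vec Term n) {θ x} → Vec.Any (x ∈ᵗ_) (ts [ θ ]ᵗˢ) →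
                 ∃[ y ] Vec.Any (y ∈ᵗ_) ts × x ∈ᵗ (θ ⟨ y ⟩)
    ∈ᵗˢ-subst⁻ (t ∷ ts) (Vec.here x∈) with ∈ᵗ-subst⁻ t x∈
    ... | y , y∈ , x∈θy = y , Vec.here y∈ , x∈θy
    ∈ᵗˢ-subst⁻ (t ∷ ts) (Vec.there x∈) with ∈ᵗˢ-subst⁻ ts x∈
    ... | y , y∈ , x∈θy = y , Vec.there y∈ , x∈θy

  mutual
    ∈ᵗ-subst⁺ : ∀ {t θ x y} → y ∈ᵗ t → x ∈ᵗ (θ ⟨ y ⟩) → x ∈ᵗ (t [ θ ]ᵗ)
    ∈ᵗ-subst⁺ here       x∈θy = x∈θy
    ∈ᵗ-subst⁺ (there y∈) x∈θy = there (∈ᵗˢ-subst⁺ y∈ x∈θy)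

    ∈ᵗˢ-subst⁺ : ∀ {n} {ts : Vec Term n} {θ x y} → Vec.Any (y ∈ᵗ_) ts →
                 x ∈ᵗ (θ ⟨ y ⟩) → Vec.Any (x ∈ᵗ_) (ts [ θ ]ᵗˢ)
    ∈ᵗˢ-subst⁺ (Vec.here y∈)  x∈θy = Vec.here (∈ᵗ-subst⁺ y∈ x∈θy)
    ∈ᵗˢ-subst⁺ (Vec.there y∈) x∈θy = Vec.there (∈ᵗˢ-subst⁺ y∈ x∈θy)

  -- Lets the general facts about `map` apply to instances of queries.
  []ᑫ≡map : ∀ Q θ → Q [ θ ]ᑫ ≡ map (_[ θ ]ᵃ) Q
  []ᑫ≡map []      θ = refl
  []ᑫ≡map (A ∷ Q) θ = cong (A [ θ ]ᵃ ∷_) ([]ᑫ≡map Q θ)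

  Any-subst⁺ : ∀ {P : Pred Atom 0ℓ} Q {θ} → Any (λ A → P (A [ θ ]ᵃ)) Q → Any P (Q [ θ ]ᑫ)
  Any-subst⁺ {P} Q {θ} = subst (Any P) (sym ([]ᑫ≡map Q θ)) ∘ Any.map⁺

  All-subst⁺ : ∀ {P : Pred Atom 0ℓ} Q {θ} → All (λ A → P (A [ θ ]ᵃ)) Q → All P (Q [ θ ]ᑫ)
  All-subst⁺ {P} Q {θ} = subst (All P) (sym ([]ᑫ≡map Q θ)) ∘ All.map⁺

  ∈ᑫ-subst⁻ : ∀ Q {θ x} → x ∈ᑫ (Q [ θ ]ᑫ) → ∃[ y ] y ∈ᑫ Q × x ∈ᵗ (θ ⟨ y ⟩)
  ∈ᑫ-subst⁻ (A ∷ Q) (here x∈) with ∈ᵗˢ-subst⁻ (args A) x∈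
  ... | y , y∈ , x∈θy = y , here y∈ , x∈θy
  ∈ᑫ-subst⁻ (A ∷ Q) (there x∈) with ∈ᑫ-subst⁻ Q x∈
  ... | y , y∈ , x∈θy = y , there y∈ , x∈θy

  ∈ᑫ-subst⁺ : ∀ Q {θ x y} → y ∈ᑫ Q → x ∈ᵗ (θ ⟨ y ⟩) → x ∈ᑫ (Q [ θ ]ᑫ)
  ∈ᑫ-subst⁺ Q y∈ x∈θy = Any-subst⁺ Q (Any.map (λ y∈A → ∈ᵗˢ-subst⁺ y∈A x∈θy) y∈)

  ∈ʳ-subst⁻ : ∀ r {θ x} → x ∈ʳ (r [ θ ]ʳ) → ∃[ y ] y ∈ʳ r × x ∈ᵗ (θ ⟨ y ⟩)
  ∈ʳ-subst⁻ (H ⟵ B) (inj₁ x∈) with ∈ᵗˢ-subst⁻ (args H) x∈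
  ... | y , y∈ , x∈θy = y , inj₁ y∈ , x∈θy
  ∈ʳ-subst⁻ (H ⟵ B) (inj₂ x∈) with ∈ᑫ-subst⁻ B x∈
  ... | y , y∈ , x∈θy = y , inj₂ y∈ , x∈θy

  HeadCovered BodyCovered : Rule → Set
  HeadCovered r = ∀ x → x ∈ʳ r → x ∈ᵃ head r
  BodyCovered r = ∀ x → x ∈ʳ r → x ∈ᑫ body r

  -- Each variable of the instance comes from `θ ⟨ y ⟩` for some `y` in `r`, and `y` also occurs in
  -- the head. This carries the hypothesis on program rules over to their variants, the input rules.
  HeadCovered-subst : ∀ r {θ} → HeadCovered r → HeadCovered (r [ θ ]ʳ)
  HeadCovered-subst r hc x x∈ with ∈ʳ-subst⁻ r x∈
  ... | y , y∈ , x∈θy = ∈ᵗˢ-subst⁺ (hc y y∈) x∈θy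

  BodyCovered-subst : ∀ r {θ} → BodyCovered r → BodyCovered (r [ θ ]ʳ)
  BodyCovered-subst r bc x x∈ with ∈ʳ-subst⁻ r x∈
  ... | y , y∈ , x∈θy = ∈ᑫ-subst⁺ (body r) (bc y y∈) x∈θy

  PredSyms-head : ∀ (P : Program) {r} → r ∈ P → (PredSyms P -Atom) (head r)
  PredSyms-head P r∈P = _ , r∈P , here refl

  PredSyms-body : ∀ (P : Program) {r} → r ∈ P → All (PredSyms P -Atom) (body r)
  PredSyms-body P r∈P = All.tabulate λ A∈ → _ , r∈P , there (Any.map (cong predSym) A∈)

  OccursIn : Pred PredSym 0ℓ → Var → Query → Set
  OccursIn F x Q = Any (λ A → (F -Atom) A × x ∈ᵃ A) Q

  -- The invariant of derivations, used with the predicate symbols of `P₂` as `F`.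
  Covered : Pred PredSym 0ℓ → Query → Set
  Covered F Q = ∀ x → x ∈ᑫ Q → OccursIn F x Q

  OccursIn-subst⁺ : ∀ {F} Q {θ x y} → OccursIn F y Q → x ∈ᵗ (θ ⟨ y ⟩) →
                    OccursIn F x (Q [ θ ]ᑫ)
  OccursIn-subst⁺ Q occ x∈θy =
    Any-subst⁺ Q (Any.map (λ (A∈F , y∈A) → A∈F , ∈ᵗˢ-subst⁺ y∈A x∈θy) occ)

  OccursIn-All⁺ : ∀ {F x Q} → All (F -Atom) Q → x ∈ᑫ Q → OccursIn F x Q
  OccursIn-All⁺ (A∈F ∷ _) (here x∈A) = here (A∈F , x∈A)
  OccursIn-All⁺ (_ ∷ Q⊆F) (there x∈) = there (OccursIn-All⁺ Q⊆F x∈)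

  module _ {F : Pred PredSym 0ℓ} (Q : Query) (i : Fin (length Q)) {r : Rule} {θ : Subst}
           (unifier : IsUnifier θ (lookup Q i) (head r)) (cov : Covered F Q) where

    private
      A : Atom
      A = lookup Q i

      R : Query
      R = take (toℕ i) Q ++ body r ++ drop (suc (toℕ i)) Q

      -- The `F`-atom of `Q` containing `y` either survives into the resolvent or is the selected
      -- atom; in the latter case the unifier passes `x` on to the instance of the head.
      old : ∀ {x y} → y ∈ᑫ Q → x ∈ᵗ (θ ⟨ y ⟩) →
            (F -Atom) (head r) × x ∈ᵃ (head r [ θ ]ᵃ) ⊎ OccursIn F x (R [ θ ]ᑫ)
      old {x} y∈Q x∈θy with replace⁺-old Q i (cov _ y∈Q)
      -- Instantiation keeps predicate symbols, so unified atoms share theirs.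
      ... | inj₁ (A∈F , y∈A) = inj₁ (subst F (cong predSym unifier) A∈F ,
                                     subst (x ∈ᵃ_) unifier (∈ᵗˢ-subst⁺ y∈A x∈θy))
      ... | inj₂ occ         = inj₂ (OccursIn-subst⁺ R occ x∈θy)

    resolvent-HeadCovered : ¬ (F -Atom) (head r) → HeadCovered r → Covered F (R [ θ ]ᑫ)
    resolvent-HeadCovered H∉F hc x x∈ with ∈ᑫ-subst⁻ R x∈
    ... | y , y∈ , x∈θy = Sum.[ (λ y∈Q → old′ y∈Q x∈θy) , new ]′ (replace⁻ Q i y∈)
      where
      old′ : ∀ {z} → z ∈ᑫ Q → x ∈ᵗ (θ ⟨ z ⟩) → OccursIn F x (R [ θ ]ᑫ)
      old′ z∈Q x∈θz = Sum.[ ⊥-elim ∘ H∉F ∘ proj₁ , id ]′ (old z∈Q x∈θz)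

      new : y ∈ᑫ body r → OccursIn F x (R [ θ ]ᑫ)
      new y∈B
        -- `hc` moves `y` into the head, so `x` occurs in the instance of the head, which is that of
        -- `A`. Hence `x` stems from a variable `z` of `A`, thus of `Q`, and `old′` applies.
        with z , z∈A , x∈θz ← ∈ᵗˢ-subst⁻ (args A)
               (subst (x ∈ᵃ_) (sym unifier) (∈ᵗˢ-subst⁺ (hc y (inj₂ y∈B)) x∈θy))
        = old′ (lose (∈-lookup i) z∈A) x∈θz

    resolvent-BodyCovered : All (F -Atom) (body r) → BodyCovered r → Covered F (R [ θ ]ᑫ)
    resolvent-BodyCovered B⊆F bc x x∈ with ∈ᑫ-subst⁻ R x∈
    ... | y , y∈ , x∈θy = Sum.[ (λ y∈Q → Sum.[ fromHead ∘ proj₂ , id ]′ (old y∈Q x∈θy))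
                              , (λ y∈B → new y∈B x∈θy) ]′ (replace⁻ Q i y∈)
      where
      new : ∀ {z} → z ∈ᑫ body r → x ∈ᵗ (θ ⟨ z ⟩) → OccursIn F x (R [ θ ]ᑫ)
      new z∈B = OccursIn-subst⁺ R (replace⁺-new Q i (OccursIn-All⁺ B⊆F z∈B))

      fromHead : x ∈ᵃ (head r [ θ ]ᵃ) → OccursIn F x (R [ θ ]ᑫ)
      -- If the selected atom was the covering one, the body takes over: `x` stems from a head
      -- variable `z`, which `bc` finds in the body.
      fromHead x∈H with z , z∈H , x∈θz ← ∈ᵗˢ-subst⁻ (args (head r)) x∈H
        = new (bc z (inj₁ z∈H)) x∈θz

  module _ {P₁ P₂ : Program}
           (disjoint : Empty (PredSyms P₁ ∩ PredSyms P₂))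
           (hc : ∀ r → r ∈ P₁ → HeadCovered r)
           (bc : ∀ r → r ∈ P₂ → BodyCovered r) where

    resolvent-Covered : ∀ {Q} (s : Step (P₁ ∪ P₂) Q) →
                        Covered (PredSyms P₂) Q → Covered (PredSyms P₂) (resolvent s)
    resolvent-Covered {Q} s cov with variant s
    ... | r , inj₁ r∈P₁ , ρ , _ , refl =
      resolvent-HeadCovered Q (selected s) {r = r [ ρ ]ʳ} (proj₁ (isMGU s)) cov
        (λ H∈F₂ → disjoint _ (PredSyms-head P₁ r∈P₁ , H∈F₂))
        (HeadCovered-subst r (hc r r∈P₁))
    ... | r , inj₂ r∈P₂ , ρ , _ , refl =
      resolvent-BodyCovered Q (selected s) {r = r [ ρ ]ʳ} (proj₁ (isMGU s)) cov
        (All-subst⁺ (body r) (PredSyms-body P₂ r∈P₂))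
        (BodyCovered-subst r (bc r r∈P₂))

    last-Covered : (d : Fragment (P₁ ∪ P₂)) →
                   Covered (PredSyms P₂) (initial d) → Covered (PredSyms P₂) (last d)
    last-Covered (start Q)      cov = cov
    last-Covered (extend d s _) cov = resolvent-Covered s (last-Covered d cov)

  -- A variable would have to occur in a `G`-atom of `Q`, but all atoms of `Q` are `F`-atoms.
  Covered⇒Ground : ∀ {F G Q} → Empty (F ∩ G) → Covered G Q → All (F -Atom) Q → All Ground Q
  Covered⇒Ground disjoint cov Q⊆F = All.tabulate λ A∈Q x x∈A →
    All.All¬⇒¬Any (All.map (λ B∈F (B∈G , _) → disjoint _ (B∈F , B∈G)) Q⊆F)
      (cov x (lose A∈Q x∈A))

theorem15 : (S : Signature) → let open SLD S in
    (P₁ P₂ : Program) →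
    let F₁ = PredSyms P₁
        F₂ = PredSyms P₂
    in
    Empty (F₁ ∩ F₂) →
    (∀ r → r ∈ P₁ → ∀ x → x ∈ʳ r → x ∈ᵃ head r) →
    (∀ r → r ∈ P₂ → ∀ x → x ∈ʳ r → x ∈ᑫ body r) →
    (R : PartialSelectionRule (P₁ ∪ P₂)) →
    (∀ Q → FlounderedQuery R Q → All (λ A → (F₁ -Atom) A × ¬ Ground A) Q) →
    (Q : Query) →
    (∀ x → x ∈ᑫ Q → Any (λ A → (F₂ -Atom) A × x ∈ᵃ A) Q) →
    (D : Derivation (P₁ ∪ P₂)) → IsDerivationFor R Q D → ¬ Flounders R D
theorem15 S P₁ P₂ disjoint hc bc R flo Q cov D isD (d , prefix , floundered@(nonempty , _))
  -- Identifies `Q` with `initial d`, so that `cov` becomes the base case of the invariant along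
  -- `d`.
  with refl , via ← isD d prefix
  = nonempty (All-contradiction (Covered⇒Ground disjoint (last-Covered disjoint hc bc d cov)
                                  (All.map proj₁ atoms)) (All.map proj₂ atoms))
  where
  open SLD S
  atoms = flo (last d) (d , via , refl , floundered)
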